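{- Every graph class with bounded tree-independence number is polynomially $\chi$-bounded. That is, if $\mathcal{G}$ is a graph class for which there is an integer $k$ with $\mathsf{tree}\text{ - }\alpha(G)\le k$ for all $G\in\mathcal{G}$, then there is a polynomial $q$ such that for every $G\in\mathcal{G}$ and every induced subgraph $G'$ of $G$, $\chi(G')\le q(\omega(G'))$.
   Context: All graphs are finite, simple, and undirected; $\chi$ and $\omega$ denote the chromatic number and the clique number. A tree decomposition of a graph $G$ is a pair $\mathcal{T}=(T,\{X_t\}_{t\in V(T)})$ where $T$ is a tree and each node $t$ is assigned a bag $X_t\subseteq V(G)$ such that every vertex of $G$ is in at least one bag, every edge of $G$ has both endpoints in some common bag, and for every $u\in V(G)$ the subgraph of $T$ induced by $\{t: u\in X_t\}$ is connected. The independence number of $\mathcal{T}$ is $\alpha(\mathcal{T})=\max_{t\in V(T)}\alpha(G[X_t])$, where $\alpha(H)$ is the maximum size of an independent set in $H$. The tree-independence number $\mathsf{tree}\text{ - }\alpha(G)$ is the minimum of $\alpha(\mathcal{T})$ over all tree decompositions $\mathcal{T}$ of $G$. -}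

module Defs where

open import Data.Empty using (⊥-elim) renaming (⊥ to Empty)
open import Data.Fin using (Fin; zero; suc; inject₁; fromℕ; finToFun; funToFin)
open import Data.Fin.Properties using (all?; any?; finToFun-funToFin) renaming (_≟_ to _≟ᶠ_)
open import Data.Fin.Subset using (Subset; inside; outside; _∈_; ∣_∣; ⊤; ⊥)
open import Data.Fin.Subset.Properties using (_∈?_; anySubset?; ∣p∣≤n; ∣⊥∣≡0; ∉⊥; ∈⊤)
open import Data.List using (List; []; _∷_; map; allFin)
open import Data.List.Extrema.Nat using (max)
open import Data.Nat using (ℕ; zero; suc; _+_; _*_; _≤_; _<_; z≤n; s≤s; NonZero)
open import Data.Nat.Properties using (≤-antisym; m≤n⇒m<n∨m≡n; ≮⇒≥) renaming (_≟_ to _≟ⁿ_)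
open import Data.Nat.Induction using (<-rec)
open import Data.Product using (∃; ∃-syntax; _×_; _,_; proj₁; proj₂)
open import Data.Sum using (inj₁; inj₂)
open import Data.Vec using ([]; _∷_; lookup; tabulate)
open import Function using (id; _∘_)
open import Function.Definitions using (Injective)
open import Level using (Level; 0ℓ) renaming (suc to lsuc; _⊔_ to _⊔ˡ_)
open import Relation.Binary using (Rel; Decidable; Symmetric)
open import Relation.Binary.Construct.Closure.ReflexiveTransitive using (Star; ε)
open import Relation.Binary.PropositionalEquality using (_≡_; _≢_; refl; subst)
open import Relation.Nullary using (¬_; yes; no)
open import Relation.Nullary.Decidable using (_×-dec_; _→-dec_; ¬?; map′)
open import Relation.Unary using (Pred) renaming (Decidable to Decidable₁)

private
  variable
    p ℓ : Level
    n : ℕ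

IsMaximum : Pred ℕ p → Pred ℕ p
IsMaximum P m = P m × (∀ {j} → P j → j ≤ m)

IsMinimum : Pred ℕ p → Pred ℕ p
IsMinimum P m = P m × (∀ {j} → P j → m ≤ j)

maximum-exists : {P : Pred ℕ p} → Decidable₁ P → P 0 →
                 ∀ b → (∀ {j} → P j → j ≤ b) → ∃ (IsMaximum P)
maximum-exists P? P0 zero bnd = 0 , P0 , bnd
maximum-exists {P = P} P? P0 (suc b) bnd with P? (suc b)
... | yes Pb = suc b , Pb , bnd
... | no ¬Pb = maximum-exists P? P0 b bnd′
  where
  bnd′ : ∀ {j} → P j → j ≤ b
  bnd′ Pj with m≤n⇒m<n∨m≡n (bnd Pj)
  ... | inj₁ (s≤s j≤b) = j≤b
  ... | inj₂ refl      = ⊥-elim (¬Pb Pj)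

minimum-exists : {P : Pred ℕ p} → Decidable₁ P → ∀ b → P b → ∃ (IsMinimum P)
minimum-exists P? b Pb with P? 0
... | yes P0 = 0 , P0 , λ _ → z≤n
minimum-exists P? zero Pb | no ¬P0 = ⊥-elim (¬P0 Pb)
minimum-exists {P = P} P? (suc b) Pb | no ¬P0
  with m , Pm , m-min ← minimum-exists (P? ∘ suc) b Pb = suc m , Pm , m-min′
  where
  m-min′ : ∀ {j} → P j → suc m ≤ j
  m-min′ {zero}  P0 = ⊥-elim (¬P0 P0)
  m-min′ {suc j} Pj = s≤s (m-min Pj)

record Graph : Set₁ where
  field
    order  : ℕ

  V : Set
  V = Fin order

  field
    Adj    : Rel V 0ℓ
    adj?   : Decidable Adj
    symm   : Symmetric Adj
    irrefl : ∀ {v} → ¬ Adj v v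

open Graph public

-- The increasing enumeration of the elements of a subset.
element : (S : Subset n) → Fin ∣ S ∣ → Fin n
element (inside  ∷ S) zero    = zero
element (inside  ∷ S) (suc i) = suc (element S i)
element (outside ∷ S) i       = suc (element S i)

-- The induced subgraph G[S], its vertices relabelled along element S.
infix 8 _[_]
_[_] : (G : Graph) → Subset (order G) → Graph
G [ S ] = record
  { order  = ∣ S ∣
  ; Adj    = λ i j → Adj G (element S i) (element S j)
  ; adj?   = λ i j → adj? G (element S i) (element S j)
  ; symm   = symm G
  ; irrefl = irrefl G
  }

module _ (G : Graph) where

  Independent : Pred (Subset (order G)) 0ℓ
  Independent S = ∀ u v → u ∈ S → v ∈ S → ¬ Adj G u v

  Clique : Pred (Subset (order G)) 0ℓ
  Clique S = ∀ u v → u ∈ S → v ∈ S → u ≢ v → Adj G u v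

  Proper : ∀ {k} → Pred (V G → Fin k) 0ℓ
  Proper c = ∀ u v → Adj G u v → c u ≢ c v

  HasIndependentSet HasClique Colourable : Pred ℕ 0ℓ
  HasIndependentSet m = ∃[ S ] Independent S × ∣ S ∣ ≡ m
  HasClique         m = ∃[ S ] Clique S × ∣ S ∣ ≡ m
  Colourable        k = ∃[ c ] Proper {k} c

  independent? : Decidable₁ Independent
  independent? S = all? λ u → all? λ v →
    (u ∈? S) →-dec (v ∈? S) →-dec ¬? (adj? G u v)

  clique? : Decidable₁ Clique
  clique? S = all? λ u → all? λ v →
    (u ∈? S) →-dec (v ∈? S) →-dec ¬? (u ≟ᶠ v) →-dec adj? G u v

  proper? : ∀ {k} → Decidable₁ (Proper {k})
  proper? c = all? λ u → all? λ v → adj? G u v →-dec ¬? (c u ≟ᶠ c v)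

  hasIndependentSet? : Decidable₁ HasIndependentSet
  hasIndependentSet? m = anySubset? λ S → independent? S ×-dec (∣ S ∣ ≟ⁿ m)

  hasClique? : Decidable₁ HasClique
  hasClique? m = anySubset? λ S → clique? S ×-dec (∣ S ∣ ≟ⁿ m)

  colourable? : Decidable₁ Colourable
  colourable? k = map′
    (λ (i , pr) → finToFun i , pr)
    (λ (c , pr) → funToFin c , λ u v uv eq →
      pr u v uv (subst (_≡ c v) (finToFun-funToFin c u)
                  (subst (finToFun (funToFin c) u ≡_) (finToFun-funToFin c v) eq)))
    (any? λ i → proper? (finToFun {k} {order G} i))

  α-exists : ∃ (IsMaximum HasIndependentSet)
  α-exists = maximum-exists hasIndependentSet?
    (⊥ , (λ _ _ u∈⊥ → ⊥-elim (∉⊥ u∈⊥)) , ∣⊥∣≡0 (order G))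
    (order G) (λ { (S , _ , refl) → ∣p∣≤n S })

  ω-exists : ∃ (IsMaximum HasClique)
  ω-exists = maximum-exists hasClique?
    (⊥ , (λ _ _ u∈⊥ → ⊥-elim (∉⊥ u∈⊥)) , ∣⊥∣≡0 (order G))
    (order G) (λ { (S , _ , refl) → ∣p∣≤n S })

  χ-exists : ∃ (IsMinimum Colourable)
  χ-exists = minimum-exists colourable? (order G)
    (id , λ { u .u uu refl → irrefl G uu })

  α ω χ : ℕ
  α = proj₁ α-exists
  ω = proj₁ ω-exists
  χ = proj₁ χ-exists

Connected : Graph → Set
Connected G = ∀ (u v : V G) → Star (Adj G) u v

-- A cycle of length 3 + l.
record Cycle (G : Graph) : Set where
  field
    l           : ℕ
    vertex      : Fin (3 + l) → V G
    distinct    : Injective _≡_ _≡_ vertex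
    consecutive : ∀ (i : Fin (2 + l)) → Adj G (vertex (inject₁ i)) (vertex (suc i))
    closing     : Adj G (vertex (fromℕ (2 + l))) (vertex zero)

record IsTree (T : Graph) : Set where
  field
    nonEmpty  : NonZero (order T)
    connected : Connected T
    acyclic   : ¬ Cycle T

record TreeDecomposition (G : Graph) : Set₁ where
  field
    T      : Graph
    isTree : IsTree T
    bag    : V T → Subset (order G)

  nodesContaining : V G → Subset (order T)
  nodesContaining u = tabulate λ t → lookup (bag t) u

  field
    vertexCover  : ∀ u → ∃[ t ] u ∈ bag t
    edgeCover    : ∀ {u v} → Adj G u v → ∃[ t ] u ∈ bag t × v ∈ bag t
    connectivity : ∀ u → Connected (T [ nodesContaining u ])

-- T is nonempty, so the default value 0 does not affect the maximum.
α-decomposition : {G : Graph} → TreeDecomposition G → ℕ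
α-decomposition {G} 𝒯 = max 0 (map (λ t → α (G [ bag t ])) (allFin (order T)))
  where open TreeDecomposition 𝒯

-- m is the tree-independence number of G.
IsTreeα : Graph → ℕ → Set₁
IsTreeα G = IsMinimum λ m → ∃[ 𝒯 ] α-decomposition {G} 𝒯 ≡ m

IsTreeα-unique : ∀ G {m m′} → IsTreeα G m → IsTreeα G m′ → m ≡ m′
IsTreeα-unique G (a , m-min) (b , m′-min) = ≤-antisym (m-min b) (m′-min a)

trivialDecomposition : ∀ G → TreeDecomposition G
trivialDecomposition G = record
  { T      = K₁
  ; isTree = record
    { nonEmpty  = _
    ; connected = λ { zero zero → ε }
    ; acyclic   = λ c → Cycle.consecutive c zero
    }
  ; bag          = λ _ → ⊤
  ; vertexCover  = λ _ → zero , ∈⊤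
  ; edgeCover    = λ _ → zero , ∈⊤ , ∈⊤
  ; connectivity = λ u → subsetConnected (tabulate λ _ → lookup ⊤ u)
  }
  where
  K₁ : Graph
  K₁ = record
    { order  = 1
    ; Adj    = λ _ _ → Empty
    ; adj?   = λ _ _ → no id
    ; symm   = id
    ; irrefl = id
    }

  subsetConnected : ∀ S → Connected (K₁ [ S ])
  subsetConnected (inside  ∷ []) zero zero = ε
  subsetConnected (outside ∷ []) ()

-- Every graph has a tree-independence number; the double negation is the
-- constructive form of the least-number principle for this set, which is not
-- given with a decision procedure.
IsTreeα-exists : ∀ G → ¬ ¬ ∃ (IsTreeα G)
IsTreeα-exists G ¬∃ = <-rec (λ m → ¬ P m) step _ (trivialDecomposition G , refl)
  where
  P : ℕ → Set₁
  P m = ∃[ 𝒯 ] α-decomposition {G} 𝒯 ≡ m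

  step : ∀ m → (∀ {j} → j < m → ¬ P j) → ¬ P m
  step m rec Pm = ¬∃ (m , Pm , λ Pj → ≮⇒≥ λ j<m → rec j<m Pj)

-- tree-α(G) ≤ k. As IsTreeα G holds of exactly one m (IsTreeα-unique,
-- IsTreeα-exists), quantifying over m universally is not vacuous.
tree-α[_]≤_ : Graph → ℕ → Set₁
tree-α[ G ]≤ k = ∀ m → IsTreeα G m → m ≤ k

GraphClass : ∀ ℓ → Set (lsuc 0ℓ ⊔ˡ lsuc ℓ)
GraphClass ℓ = Pred Graph ℓ

BoundedTreeα : GraphClass ℓ → Set (lsuc 0ℓ ⊔ˡ ℓ)
BoundedTreeα 𝒢 = ∃[ k ] ∀ G → 𝒢 G → tree-α[ G ]≤ k

-- Coefficients, constant term first. Coefficients in ℕ lose no generality for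
-- upper bounds: replacing each coefficient by its absolute value, rounded up,
-- does not decrease the value at any natural number.
Polynomial : Set
Polynomial = List ℕ

eval : Polynomial → ℕ → ℕ
eval []      x = 0
eval (a ∷ q) x = a + x * eval q x

PolynomiallyχBounded : GraphClass ℓ → Set (lsuc 0ℓ ⊔ˡ ℓ)
PolynomiallyχBounded 𝒢 =
  ∃[ q ] ∀ G → 𝒢 G → ∀ (S : Subset (order G)) → χ (G [ S ]) ≤ eval q (ω (G [ S ]))

{-# OPTIONS --safe #-}
module Submission where

-- By Ramsey's theorem, a bag of independence number at most k in a graph of
-- clique number w has fewer than 1 + w + ⋯ + w ^ k vertices, so it suffices to
-- colour a graph with that many colours so that the colouring is injective on
-- every bag. Grow a connected set A of nodes of the tree, one node at a time. If
-- t is a new node adjacent to a ∈ A, then every vertex of the bag of t that is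
-- already coloured lies in the bag of a: otherwise there is a walk from t to a
-- that does not use the edge ta, and the tree has a cycle. Hence the colouring is
-- injective on the coloured vertices of the bag of t, and the others receive
-- fresh colours.

open import Defs

open import Data.Empty using (⊥)
open import Data.Fin using (Fin; zero; suc; inject₁; fromℕ; fromℕ<)
open import Data.Fin.Properties using (any?; injective⇒≤; suc-injective) renaming (_≟_ to _≟ᶠ_)
open import Data.Fin.Subset using (Subset; inside; outside; ∣_∣) renaming (_∈_ to _∈ˢ_)
open import Data.Fin.Subset.Properties using () renaming (_∈?_ to _∈ˢ?_)
open import Data.List using (List; []; _∷_; map; length; lookup; filter; replicate; allFin)
open import Data.List.Extrema.Nat using (xs≤max)
open import Data.List.Membership.Propositional using (_∈_; _∉_; find)
open import Data.List.Membership.Propositional.Properties using (∈-map⁺; ∈-filter⁺; ∈-filter⁻; ∈-allFin; ∈-lookup)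
open import Data.List.Properties using (length-map)
open import Data.List.Relation.Binary.Subset.Propositional using (_⊆_)
open import Data.List.Relation.Unary.All as All using (All; []; _∷_)
open import Data.List.Relation.Unary.All.Properties as All using (all-filter; ¬Any⇒All¬)
open import Data.List.Relation.Unary.AllPairs as AllPairs using (AllPairs; []; _∷_)
open import Data.List.Relation.Unary.AllPairs.Properties as AllPairs using ()
open import Data.List.Relation.Unary.Any as Any using (Any; here; there; index)
open import Data.List.Relation.Unary.Any.Properties using (lookup-index)
open import Data.List.Relation.Unary.Unique.Propositional using (Unique)
import Data.List.Relation.Unary.Unique.Propositional.Properties as Unique
open import Data.Nat using (ℕ; zero; suc; _+_; _*_; _≤_; _<_; z≤n; s≤s; >-nonZero⁻¹; _≤?_)
open import Data.Nat.Properties using (≤-refl; ≤-reflexive; ≤-trans; +-suc; +-mono-≤; +-monoʳ-≤; *-mono-≤; n≤1+n; <⇒≱; ≰⇒>; <-irrefl; module ≤-Reasoning)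
open import Data.Nat.Tactic.RingSolver using (solve-∀)
open import Data.Product using (∃; ∃-syntax; _×_; _,_; proj₁; proj₂)
open import Data.Sum using (_⊎_; inj₁; inj₂; [_,_]′)
open import Data.Vec using (_∷_; tabulate; here; there)
open import Data.Vec.Functional using (updateAt)
open import Data.Vec.Functional.Properties using (updateAt-updates; updateAt-minimal)
open import Data.Vec.Properties using (lookup⇒[]=; []=⇒lookup; lookup∘tabulate)
open import Function using (_∘_; id; const; case_of_)
open import Function.Definitions using (Injective)
open import Level using (0ℓ)
open import Relation.Binary using (Rel; Symmetric)
open import Relation.Binary.Construct.Closure.ReflexiveTransitive as Star using (Star; ε; _◅_; _◅◅_)
open import Relation.Binary.PropositionalEquality using (_≡_; _≢_; refl; sym; trans; cong; cong₂; subst; ≢-sym)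
open import Relation.Nullary using (¬_; yes; no; does; contradiction)
open import Relation.Nullary.Decidable using (decidable-stable; dec-true; ¬?; _⊎-dec_)
open import Relation.Unary using (Pred; Decidable)

private
  variable
    n N : ℕ
    A : Set

  module _ {n : ℕ} where
    open import Data.List.Membership.DecPropositional (_≟ᶠ_ {n}) public using (_∈?_)

-- Lists without repetitions

lookup-injective : ∀ {xs : List A} → Unique xs → Injective _≡_ _≡_ (lookup xs)
lookup-injective (_ ∷ _)   {zero}  {zero}  _  = refl
lookup-injective (x≢ ∷ _)  {zero}  {suc j} eq = contradiction eq (All.lookup x≢ (∈-lookup j))
lookup-injective (x≢ ∷ _)  {suc i} {zero}  eq = contradiction (sym eq) (All.lookup x≢ (∈-lookup i))
lookup-injective (_ ∷ xs!) {suc i} {suc j} eq = cong suc (lookup-injective xs! eq)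

allPairs-lookup : ∀ {R : Rel A 0ℓ} {xs u v} → Symmetric R → AllPairs R xs →
                  u ∈ xs → v ∈ xs → u ≢ v → R u v
allPairs-lookup R-sym (_ ∷ _)  (here refl) (here refl) u≢v = contradiction refl u≢v
allPairs-lookup R-sym (r ∷ _)  (here refl) (there v∈)  _   = All.lookup r v∈
allPairs-lookup R-sym (r ∷ _)  (there u∈)  (here refl) _   = R-sym (All.lookup r u∈)
allPairs-lookup R-sym (_ ∷ rs) (there u∈)  (there v∈)  u≢v = allPairs-lookup R-sym rs u∈ v∈ u≢v

length-filter-complement : ∀ {P : Pred A 0ℓ} (P? : Decidable P) xs →
  length (filter P? xs) + length (filter (¬? ∘ P?) xs) ≡ length xs
length-filter-complement P? []       = refl
length-filter-complement P? (x ∷ xs) with P? x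
... | yes _ = cong suc (length-filter-complement P? xs)
... | no  _ = trans (+-suc _ _) (cong suc (length-filter-complement P? xs))

-- If nothing were missing, taking positions in `xs` would embed `Fin N` into `Fin (length xs)`.
fresh : (xs : List (Fin N)) → length xs < N → ∃ (_∉ xs)
fresh xs xs<N with any? (λ i → ¬? (i ∈? xs))
... | yes p = p
... | no ¬∃ = contradiction (injective⇒≤ index-injective) (<⇒≱ xs<N)
  where
  member : ∀ i → i ∈ xs
  member i = decidable-stable (i ∈? xs) (λ i∉ → ¬∃ (i , i∉))

  index-injective : Injective _≡_ _≡_ (index ∘ member)
  index-injective {i} {j} eq =
    trans (lookup-index (member i)) (trans (cong (lookup xs) eq) (sym (lookup-index (member j))))

-- Subsets and their enumerations

element-∈ : (p : Subset n) (i : Fin ∣ p ∣) → element p i ∈ˢ p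
element-∈ (inside  ∷ p) zero    = here
element-∈ (inside  ∷ p) (suc i) = there (element-∈ p i)
element-∈ (outside ∷ p) i       = there (element-∈ p i)

element-injective : (p : Subset n) → Injective _≡_ _≡_ (element p)
element-injective (inside  ∷ p) {zero}  {zero}  _  = refl
element-injective (inside  ∷ p) {suc i} {suc j} eq = cong suc (element-injective p (suc-injective eq))
element-injective (outside ∷ p) eq                 = element-injective p (suc-injective eq)

element-surjective : ∀ {p : Subset n} {x} → x ∈ˢ p → ∃[ i ] element p i ≡ x
element-surjective {p = inside ∷ p} here = zero , refl
element-surjective {p = inside ∷ p} (there x∈p) with i , eq ← element-surjective x∈p = suc i , cong suc eq
element-surjective {p = outside ∷ p} (there x∈p) with i , eq ← element-surjective x∈p = i , cong suc eq

map-element-surjective : ∀ {p : Subset n} {xs} → All (_∈ˢ p) xs → ∃[ is ] map (element p) is ≡ xs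
map-element-surjective [] = [] , refl
map-element-surjective (x∈p ∷ xs∈p)
  with i , eq ← element-surjective x∈p | is , eqs ← map-element-surjective xs∈p
  = i ∷ is , cong₂ _∷_ eq eqs

fromList : List (Fin n) → Subset n
fromList xs = tabulate λ x → does (x ∈? xs)

∈-fromList⁺ : ∀ {xs} {x : Fin n} → x ∈ xs → x ∈ˢ fromList xs
∈-fromList⁺ {xs = xs} {x} x∈xs =
  lookup⇒[]= x _ (trans (lookup∘tabulate _ x) (dec-true (x ∈? xs) x∈xs))

∈-fromList⁻ : ∀ xs {x : Fin n} → x ∈ˢ fromList xs → x ∈ xs
∈-fromList⁻ xs {x} x∈p
  with x ∈? xs | trans (sym (lookup∘tabulate (λ y → does (y ∈? xs)) x)) ([]=⇒lookup x∈p)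
... | yes x∈xs | _  = x∈xs
... | no _     | ()

length≤∣fromList∣ : ∀ {xs : List (Fin n)} → Unique xs → length xs ≤ ∣ fromList xs ∣
length≤∣fromList∣ {xs = xs} xs! = injective⇒≤ {f = proj₁ ∘ position} position-injective
  where
  position : ∀ i → ∃[ j ] element (fromList xs) j ≡ lookup xs i
  position i = element-surjective (∈-fromList⁺ (∈-lookup {xs = xs} i))

  position-injective : Injective _≡_ _≡_ (proj₁ ∘ position)
  position-injective {i} {j} eq = lookup-injective xs!
    (trans (sym (proj₂ (position i))) (trans (cong (element (fromList xs)) eq) (proj₂ (position j))))

-- Ramsey's theorem

-- Distinctness is included so that a pairwise `NonAdj` list has no repetitions and its length
-- counts vertices; for `Adj` this follows from irreflexivity.
NonAdj : (G : Graph) → Rel (V G) 0ℓ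
NonAdj G u v = u ≢ v × ¬ Adj G u v

clique-length≤ω : ∀ G {xs} → AllPairs (Adj G) xs → length xs ≤ ω G
clique-length≤ω G {xs} adj = ≤-trans (length≤∣fromList∣ (AllPairs.map adj⇒≢ adj))
  (proj₂ (proj₂ (ω-exists G)) (fromList xs , clique , refl))
  where
  adj⇒≢ : ∀ {u v} → Adj G u v → u ≢ v
  adj⇒≢ uv refl = irrefl G uv

  clique : Clique G (fromList xs)
  clique u v u∈ v∈ = allPairs-lookup (symm G) adj (∈-fromList⁻ xs u∈) (∈-fromList⁻ xs v∈)

independent-length≤α : ∀ G {xs} → AllPairs (NonAdj G) xs → length xs ≤ α G
independent-length≤α G {xs} nonadj = ≤-trans (length≤∣fromList∣ (AllPairs.map proj₁ nonadj))
  (proj₂ (proj₂ (α-exists G)) (fromList xs , independent , refl))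
  where
  NonAdj-sym : Symmetric (NonAdj G)
  NonAdj-sym (u≢v , ¬uv) = ≢-sym u≢v , ¬uv ∘ symm G

  independent : Independent G (fromList xs)
  independent u v u∈ v∈ uv with u ≟ᶠ v
  ... | yes refl = irrefl G uv
  ... | no u≢v   = proj₂ (allPairs-lookup NonAdj-sym nonadj (∈-fromList⁻ xs u∈) (∈-fromList⁻ xs v∈) u≢v) uv

independent-length≤α-induced : ∀ G (p : Subset (order G)) {xs} → All (_∈ˢ p) xs →
                               AllPairs (NonAdj G) xs → length xs ≤ α (G [ p ])
independent-length≤α-induced G p xs∈p nonadj with map-element-surjective xs∈p
... | is , refl = subst (_≤ α (G [ p ])) (sym (length-map (element p) is))
  (independent-length≤α (G [ p ]) (AllPairs.map (λ (u≢v , ¬uv) → (u≢v ∘ cong (element p)) , ¬uv) (AllPairs.map⁻ nonadj)))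

geometric : ℕ → Polynomial
geometric k = replicate (suc k) 1

eval-mono : ∀ q {x y} → x ≤ y → eval q x ≤ eval q y
eval-mono []      x≤y = z≤n
eval-mono (a ∷ q) x≤y = +-monoʳ-≤ a (*-mono-≤ x≤y (eval-mono q x≤y))

-- The recurrence behind the Ramsey induction: one summand for the neighbours of a vertex, one for
-- its non-neighbours. By monotonicity it reduces to `(1 + w * y) + y = 1 + (1 + w) * y`.
geometric-step : ∀ k w →
  eval (geometric (suc k)) w + eval (geometric k) (suc w) ≤ eval (geometric (suc k)) (suc w)
geometric-step k w = begin
  suc (w * eval (geometric k) w) + eval (geometric k) (suc w)
    ≤⟨ s≤s (+-mono-≤ (*-mono-≤ (≤-refl {w}) (eval-mono (geometric k) (n≤1+n w))) ≤-refl) ⟩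
  suc (w * eval (geometric k) (suc w)) + eval (geometric k) (suc w)
    ≡⟨ rearrange w (eval (geometric k) (suc w)) ⟩
  suc (suc w * eval (geometric k) (suc w)) ∎
  where
  open ≤-Reasoning
  rearrange : ∀ w x → suc (w * x) + x ≡ suc (suc w * x)
  rearrange = solve-∀

-- In `ramsey` the `suc` accounts for the head, removed before the list is split.
pigeonhole₂ : ∀ {a b c d} → a + b ≤ suc (c + d) → a ≤ c ⊎ b ≤ d
pigeonhole₂ {a} {b} {c} {d} le with a ≤? c | b ≤? d
... | yes a≤c | _       = inj₁ a≤c
... | no _    | yes b≤d = inj₂ b≤d
... | no a≰c  | no b≰d  = contradiction
  (≤-trans (subst (_≤ a + b) (cong suc (+-suc c d)) (+-mono-≤ (≰⇒> a≰c) (≰⇒> b≰d))) le) (<-irrefl refl)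

-- Split the tail into neighbours and non-neighbours of the head `x`; one part is large enough to
-- recurse. In the base cases the bound is 1 and a single vertex serves. `P` is arbitrary so that
-- recursive calls can also record how the vertices found relate to `x`.
ramsey : ∀ G {P : Pred (V G) 0ℓ} k w xs → Unique xs → All P xs →
         eval (geometric k) w ≤ length xs →
         (∃[ ys ] length ys ≡ suc w × All P ys × AllPairs (Adj G) ys) ⊎
         (∃[ ys ] length ys ≡ suc k × All P ys × AllPairs (NonAdj G) ys)
ramsey G zero    w    (x ∷ xs) _ (Px ∷ _) _ = inj₂ (x ∷ [] , refl , Px ∷ [] , [] ∷ [])
ramsey G (suc k) zero (x ∷ xs) _ (Px ∷ _) _ = inj₁ (x ∷ [] , refl , Px ∷ [] , [] ∷ [])
ramsey G {P} (suc k) (suc w) (x ∷ xs) (x≢ ∷ xs!) (Px ∷ Pxs) large =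
  [ among-neighbours , among-nonneighbours ]′ (pigeonhole₂ (≤-trans (geometric-step k w)
    (≤-trans large (≤-reflexive (cong suc (sym (length-filter-complement (adj? G x) xs)))))))
  where
  Clq = λ P m → ∃[ ys ] length ys ≡ m × All P ys × AllPairs (Adj G) ys
  Ind = λ P m → ∃[ ys ] length ys ≡ m × All P ys × AllPairs (NonAdj G) ys
  nbrs    = filter (adj? G x) xs
  nonnbrs = filter (¬? ∘ adj? G x) xs

  among-neighbours : eval (geometric (suc k)) w ≤ length nbrs → Clq P (2 + w) ⊎ Ind P (2 + k)
  among-neighbours le
    -- A clique among the neighbours grows by `x`; an independent set already has the required size.
    with ramsey G {λ u → P u × Adj G x u} (suc k) w nbrs (Unique.filter⁺ (adj? G x) xs!)
           (All.zip (All.filter⁺ (adj? G x) Pxs , all-filter (adj? G x) xs)) le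
  ... | inj₁ (ys , len , Qys , adj) =
    inj₁ (x ∷ ys , cong suc len , Px ∷ All.map proj₁ Qys , All.map proj₂ Qys ∷ adj)
  ... | inj₂ (ys , len , Qys , nonadj) = inj₂ (ys , len , All.map proj₁ Qys , nonadj)

  among-nonneighbours : eval (geometric k) (suc w) ≤ length nonnbrs → Clq P (2 + w) ⊎ Ind P (2 + k)
  among-nonneighbours le
    -- Here the independent set grows by `x`, with `x≢` supplying distinctness.
    with ramsey G {λ u → P u × NonAdj G x u} k (suc w) nonnbrs (Unique.filter⁺ (¬? ∘ adj? G x) xs!)
           (All.zip (All.filter⁺ (¬? ∘ adj? G x) Pxs
                    , All.zip (All.filter⁺ (¬? ∘ adj? G x) x≢ , all-filter (¬? ∘ adj? G x) xs))) le
  ... | inj₁ (ys , len , Qys , adj) = inj₁ (ys , len , All.map proj₁ Qys , adj)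
  ... | inj₂ (ys , len , Qys , nonadj) =
    inj₂ (x ∷ ys , cong suc len , Px ∷ All.map proj₁ Qys , All.map proj₂ Qys ∷ nonadj)

-- Walks in acyclic graphs

module _ {R : Rel (Fin n) 0ℓ} where

  -- Indexed by the list of its vertices, so that the list can serve directly as the vertices of a
  -- cycle.
  data Path (b : Fin n) : List (Fin n) → Set where
    end  : Path b (b ∷ [])
    step : ∀ {x y ys} → R x y → x ∉ y ∷ ys → Path b (y ∷ ys) → Path b (x ∷ y ∷ ys)

  path-suffix : ∀ {a b xs} → Path b xs → a ∈ xs → ∃[ ys ] Path b (a ∷ ys)
  path-suffix end          (here refl) = _ , end
  path-suffix (step r x∉ p) (here refl) = _ , step r x∉ p
  path-suffix (step r x∉ p) (there a∈)  = path-suffix p a∈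

  -- If `a` recurs on the path already built, keep only the suffix starting there.
  loop-erase : ∀ {a b} → Star R a b → ∃[ ys ] Path b (a ∷ ys)
  loop-erase ε = [] , end
  loop-erase {a} (_◅_ {j = y} r walk) with ys , p ← loop-erase walk with a ∈? y ∷ ys
  ... | yes a∈ = path-suffix p a∈
  ... | no a∉  = y ∷ ys , step r a∉ p

  path-unique : ∀ {b xs} → Path b xs → Unique xs
  path-unique end           = [] ∷ []
  path-unique (step _ x∉ p) = ¬Any⇒All¬ _ x∉ ∷ path-unique p

  path-consecutive : ∀ {b x xs} → Path b (x ∷ xs) → ∀ i → R (lookup (x ∷ xs) (inject₁ i)) (lookup (x ∷ xs) (suc i))
  path-consecutive (step r _ _) zero    = r
  path-consecutive (step _ _ p) (suc i) = path-consecutive p i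

  path-last : ∀ {b x xs} → Path b (x ∷ xs) → lookup (x ∷ xs) (fromℕ (length xs)) ≡ b
  path-last end          = refl
  path-last (step _ _ p) = path-last p

-- Erase the loops of such a walk. Length 0 would make `ab` a loop, length 1 would be the forbidden
-- step itself, and a longer path closes up through `ab` to a cycle.
acyclic⇒edge-is-bridge : ∀ {T a b} → ¬ Cycle T → Adj T a b →
  ¬ Star (λ x y → Adj T x y × (x ≢ a ⊎ y ≢ b)) a b
acyclic⇒edge-is-bridge {T} {a} {b} acyclic ab walk with loop-erase walk
... | [] , end = irrefl T ab
... | _ ∷ [] , step (_ , inj₁ a≢a) _ end = a≢a refl
... | _ ∷ [] , step (_ , inj₂ b≢b) _ end = b≢b refl
... | y ∷ z ∷ zs , p = acyclic record
  { l           = length zs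
  ; vertex      = lookup (a ∷ y ∷ z ∷ zs)
  ; distinct    = lookup-injective (path-unique p)
  ; consecutive = λ i → proj₁ (path-consecutive p i)
  ; closing     = subst (λ v → Adj T v a) (sym (path-last p)) (symm T ab)
  }

-- Colourings that are injective on the bags

InjectiveOn : Pred (Fin n) 0ℓ → Pred (Fin n → Fin N) 0ℓ
InjectiveOn P c = ∀ {u v} → P u → P v → c u ≡ c v → u ≡ v

-- Greedy: keep the colours on `D` and give fresh ones to the other entries of `ys`, one at a time.
extend-injectively : ∀ {D : Pred (Fin n) 0ℓ} (D? : Decidable D) (c : Fin n → Fin N) ys → length ys < N →
  InjectiveOn (λ u → u ∈ ys × D u) c →
  ∃[ c′ ] (∀ {u} → D u → c′ u ≡ c u) × InjectiveOn (_∈ ys) c′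
extend-injectively {n} {N} D? c ys ys<N = go ys inj₂ D? c
  where
  -- `D` grows to the set of vertices with final colours; `zs` holds the entries still to be
  -- examined.
  go : ∀ zs {D : Pred (Fin n) 0ℓ} → (∀ {y} → y ∈ ys → D y ⊎ y ∈ zs) → Decidable D → (c : Fin n → Fin N) →
       InjectiveOn (λ u → u ∈ ys × D u) c →
       ∃[ c′ ] (∀ {u} → D u → c′ u ≡ c u) × InjectiveOn (_∈ ys) c′
  go [] {D} done _ c inj = c , (λ _ → refl) , λ u∈ v∈ → inj (u∈ , D-holds u∈) (v∈ , D-holds v∈)
    where
    D-holds : ∀ {y} → y ∈ ys → D y
    D-holds y∈ with inj₁ Dy ← done y∈ = Dy
  go (z ∷ zs) {D} todo D? c inj with D? z
  ... | yes Dz = go zs todo′ D? c inj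
    where
    todo′ : ∀ {y} → y ∈ ys → D y ⊎ y ∈ zs
    todo′ y∈ with todo y∈
    ... | inj₁ Dy          = inj₁ Dy
    ... | inj₂ (here refl) = inj₁ Dz
    ... | inj₂ (there y∈′) = inj₂ y∈′
  -- The new colour avoids the current colours of all of `ys`, provisional ones included; hence the
  -- strict bound on the length.
  ... | no ¬Dz with new , new∉ ← fresh (map c ys) (subst (_< N) (sym (length-map c ys)) ys<N)
    = let c″ , agrees , inj″ = go zs todo′ (λ u → D? u ⊎-dec (u ≟ᶠ z)) c′ inj′
      in c″ , (λ Du → trans (agrees (inj₁ Du)) (unchanged Du)) , inj″
    where
    c′ : Fin n → Fin N
    c′ = updateAt c z (const new)

    unchanged : ∀ {u} → D u → c′ u ≡ c u
    unchanged {u} Du = updateAt-minimal u z c λ { refl → ¬Dz Du }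

    todo′ : ∀ {y} → y ∈ ys → (D y ⊎ y ≡ z) ⊎ y ∈ zs
    todo′ y∈ with todo y∈
    ... | inj₁ Dy          = inj₁ (inj₁ Dy)
    ... | inj₂ (here y≡z)  = inj₁ (inj₂ y≡z)
    ... | inj₂ (there y∈′) = inj₂ y∈′

    new-differs : ∀ {u} → u ∈ ys → D u → c′ u ≢ c′ z
    new-differs {u} u∈ Du eq = new∉ (subst (_∈ map c ys)
      (trans (sym (unchanged Du)) (trans eq (updateAt-updates z c))) (∈-map⁺ c u∈))

    inj′ : InjectiveOn (λ u → u ∈ ys × (D u ⊎ u ≡ z)) c′
    inj′ (u∈ , inj₁ Du)   (v∈ , inj₁ Dv)   eq = inj (u∈ , Du) (v∈ , Dv) (trans (sym (unchanged Du)) (trans eq (unchanged Dv)))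
    inj′ (u∈ , inj₁ Du)   (v∈ , inj₂ refl) eq = contradiction eq (new-differs u∈ Du)
    inj′ (u∈ , inj₂ refl) (v∈ , inj₁ Dv)   eq = contradiction (sym eq) (new-differs v∈ Dv)
    inj′ (u∈ , inj₂ refl) (v∈ , inj₂ refl) eq = refl

module BagColouring
  (T : Graph) (T-tree : IsTree T)
  (Bag : V T → Pred (Fin n) 0ℓ) (bag? : ∀ t → Decidable (Bag t))
  (bag-connected : ∀ {u s t} → Bag s u → Bag t u → Star (λ x y → Adj T x y × Bag y u) s t)
  (bag-small : ∀ t → length (filter (bag? t) (allFin n)) < N)
  where

  open IsTree T-tree

  members : V T → List (Fin n)
  members t = filter (bag? t) (allFin n)

  ∈-members⁺ : ∀ {t u} → Bag t u → u ∈ members t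
  ∈-members⁺ {t} = ∈-filter⁺ (bag? t) (∈-allFin _)

  ∈-members⁻ : ∀ {t u} → u ∈ members t → Bag t u
  ∈-members⁻ {t} u∈ = proj₂ (∈-filter⁻ (bag? t) {xs = allFin n} u∈)

  -- `A` lists the nodes processed so far. `colour` is total, but only its values on the bags of `A`
  -- are final.
  record PartialColouring (A : List (V T)) : Set where
    field
      colour    : Fin n → Fin N
      linked    : ∀ {s t} → s ∈ A → t ∈ A → Star (λ x y → Adj T x y × x ∈ A) s t
      injective : ∀ {t} → t ∈ A → InjectiveOn (Bag t) colour

  open PartialColouring

  initial : ∀ r → (Fin n → Fin N) → PartialColouring (r ∷ [])
  initial r c with extend-injectively {D = λ _ → ⊥} (λ _ → no id) c (members r) (bag-small r) (λ ())
  ... | c′ , _ , inj = record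
    { colour    = c′
    ; linked    = λ { (here refl) (here refl) → ε }
    ; injective = λ { (here refl) Bu Bv → inj (∈-members⁺ Bu) (∈-members⁺ Bv) }
    }

  -- Walk from `t` through nodes whose bags contain `u` to some `s` in `A`, then inside `A` to `a`.
  -- If `u` were not in the bag of `a`, the first half would never step onto `a`; the second never
  -- steps out of `t`, which is not in `A`. So the walk would bypass the bridge from `t` to `a`.
  coloured-in-neighbour : ∀ {A a t u} → PartialColouring A → a ∈ A → Adj T a t → t ∉ A →
                          Bag t u → Any (λ s → Bag s u) A → Bag a u
  coloured-in-neighbour {A} {a} {t} {u} c a∈A at t∉A Bt coloured
    with s , s∈A , Bs ← find coloured = decidable-stable (bag? a u) λ ¬Ba →
      acyclic⇒edge-is-bridge acyclic (symm T at)
        (Star.map (λ (xy , By) → xy , inj₂ λ { refl → ¬Ba By }) (bag-connected Bt Bs)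
         ◅◅ Star.map (λ (xy , x∈A) → xy , inj₁ λ { refl → t∉A x∈A }) (linked c s∈A a∈A))

  add-node : ∀ {A a t} → PartialColouring A → a ∈ A → Adj T a t → t ∉ A → PartialColouring (t ∷ A)
  add-node {A} {a} {t} c a∈A at t∉A
    -- The final vertices are those in some bag of `A`. Those that also lie in the bag of `t` lie in
    -- the bag of `a`, where the old colouring is injective.
    with extend-injectively (λ u → Any.any? (λ s → bag? s u) A) (colour c) (members t) (bag-small t)
           (λ (u∈ , Du) (v∈ , Dv) → injective c a∈A
             (coloured-in-neighbour c a∈A at t∉A (∈-members⁻ u∈) Du)
             (coloured-in-neighbour c a∈A at t∉A (∈-members⁻ v∈) Dv))
  ... | c′ , agrees , inj = record
    { colour    = c′
    ; linked    = linked′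
    ; injective = injective′
    }
    where
    old : ∀ {x y} → x ∈ A → y ∈ A → Star (λ x y → Adj T x y × x ∈ t ∷ A) x y
    old x∈ y∈ = Star.map (λ (xy , x∈) → xy , there x∈) (linked c x∈ y∈)

    linked′ : ∀ {x y} → x ∈ t ∷ A → y ∈ t ∷ A → Star (λ x y → Adj T x y × x ∈ t ∷ A) x y
    linked′ (here refl) (here refl) = ε
    linked′ (here refl) (there y∈)  = (symm T at , here refl) ◅ old a∈A y∈
    linked′ (there x∈)  (here refl) = old x∈ a∈A ◅◅ (at , there a∈A) ◅ ε
    linked′ (there x∈)  (there y∈)  = old x∈ y∈

    injective′ : ∀ {s} → s ∈ t ∷ A → InjectiveOn (Bag s) c′
    injective′ (here refl) Bu Bv    = inj (∈-members⁺ Bu) (∈-members⁺ Bv)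
    -- Vertices of an old bag keep their colours.
    injective′ (there s∈)  Bu Bv eq = injective c s∈ Bu Bv (trans (sym (agrees (coloured Bu))) (trans eq (agrees (coloured Bv))))
      where
      coloured : ∀ {u} → Bag _ u → Any (λ s → Bag s u) A
      coloured Bu = Any.map (λ { refl → Bu }) s∈

  Extension : List (V T) → Pred (V T) 0ℓ → Set
  Extension A Q = ∃[ A′ ] PartialColouring A′ × A ⊆ A′ × (∀ {t} → Q t → t ∈ A′)

  -- Follow the walk from a node of `A`: each node not yet in `A` is added through its predecessor.
  reach : ∀ {A a t} → PartialColouring A → a ∈ A → Star (Adj T) a t → Extension A (_≡ t)
  reach c a∈A ε = _ , c , id , λ { refl → a∈A }
  reach {A} c a∈A (_◅_ {j = x} ax walk) with x ∈? A
  ... | yes x∈A = reach c x∈A walk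
  ... | no x∉A with A′ , c′ , A⊆A′ , t∈A′ ← reach (add-node c a∈A ax x∉A) (here refl) walk
    = A′ , c′ , A⊆A′ ∘ there , t∈A′

  reach-all : ∀ {A a} → PartialColouring A → a ∈ A → ∀ ts → Extension A (_∈ ts)
  reach-all c a∈A [] = _ , c , id , λ ()
  reach-all {a = a} c a∈A (t ∷ ts)
    with A′ , c′ , A⊆A′ , t∈A′ ← reach c a∈A (connected a t)
    with A″ , c″ , A′⊆A″ , ts⊆A″ ← reach-all c′ (A⊆A′ a∈A) ts
    = A″ , c″ , A′⊆A″ ∘ A⊆A′ , λ { (here eq) → A′⊆A″ (t∈A′ eq) ; (there t∈) → ts⊆A″ t∈ }

  bag-colouring : V T → (Fin n → Fin N) → ∃[ c ] ∀ t → InjectiveOn (Bag t) c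
  bag-colouring r c₀ with A , c , _ , all∈A ← reach-all (initial r c₀) (here refl) (allFin (order T))
    = colour c , λ t → injective c (all∈A (∈-allFin t))

-- Tree decompositions and induced subgraphs

module _ {G : Graph} (𝒯 : TreeDecomposition G) where
  open TreeDecomposition 𝒯

  bag-α≤α-decomposition : ∀ t → α (G [ bag t ]) ≤ α-decomposition 𝒯
  bag-α≤α-decomposition t =
    All.lookup (xs≤max 0 (map (λ t → α (G [ bag t ])) (allFin (order T)))) (∈-map⁺ _ (∈-allFin t))

  ∈-nodesContaining⁺ : ∀ {u t} → u ∈ˢ bag t → t ∈ˢ nodesContaining u
  ∈-nodesContaining⁺ {t = t} u∈ = lookup⇒[]= t _ (trans (lookup∘tabulate _ t) ([]=⇒lookup u∈))

  ∈-nodesContaining⁻ : ∀ {u t} → t ∈ˢ nodesContaining u → u ∈ˢ bag t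
  ∈-nodesContaining⁻ {u} {t} t∈ = lookup⇒[]= u _ (trans (sym (lookup∘tabulate _ t)) ([]=⇒lookup t∈))

  -- `element` carries walks of the relabelled subtree back to `T`.
  bags-connected : ∀ {u s t} → u ∈ˢ bag s → u ∈ˢ bag t → Star (λ x y → Adj T x y × u ∈ˢ bag y) s t
  bags-connected {u} u∈s u∈t
    with i , refl ← element-surjective (∈-nodesContaining⁺ u∈s)
       | j , refl ← element-surjective (∈-nodesContaining⁺ u∈t)
    = Star.gmap (element (nodesContaining u)) (λ {_} {y} xy → xy , ∈-nodesContaining⁻ (element-∈ _ y)) (connectivity u i j)

  module _ {k} (α≤k : α-decomposition 𝒯 ≤ k) (S : Subset (order G)) where

    -- The bags pulled back to `G [ S ]`, over the same tree.
    Bag : V T → Pred (V (G [ S ])) 0ℓ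
    Bag t u = element S u ∈ˢ bag t

    bag? : ∀ t → Decidable (Bag t)
    bag? t u = element S u ∈ˢ? bag t

    -- A larger bag would yield, by Ramsey, a clique of `G [ S ]` with more than `ω` vertices or an
    -- independent set of `k + 1` vertices inside the bag.
    bag-small : ∀ t → length (filter (bag? t) (allFin ∣ S ∣)) < eval (geometric k) (ω (G [ S ]))
    bag-small t = ≰⇒> λ large → case ramsey (G [ S ]) {Bag t} k (ω (G [ S ])) _
        (Unique.filter⁺ (bag? t) (Unique.allFin⁺ ∣ S ∣)) (all-filter (bag? t) (allFin ∣ S ∣)) large of λ
      { (inj₁ (ys , len , _ , adj)) →
          <⇒≱ (≤-reflexive (sym len)) (clique-length≤ω (G [ S ]) adj)
      -- The independent set lives in `G [ S ]` while the bound concerns `G [ bag t ]`, so it is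
      -- moved through `G`.
      ; (inj₂ (ys , len , Bys , nonadj)) → <⇒≱ (≤-reflexive (sym len)) (≤-trans
          (subst (_≤ α (G [ bag t ])) (length-map (element S) ys)
            (independent-length≤α-induced G (bag t) (All.map⁺ Bys)
              (AllPairs.map⁺ (AllPairs.map (λ (u≢v , ¬uv) → (u≢v ∘ element-injective S) , ¬uv) nonadj))))
          (≤-trans (bag-α≤α-decomposition t) α≤k))
      }

    χ≤geometric : χ (G [ S ]) ≤ eval (geometric k) (ω (G [ S ]))
    χ≤geometric
      with c , inj ← BagColouring.bag-colouring T isTree Bag bag? bags-connected bag-small
             -- Any root and any initial colouring will do; `zero` is a colour because `geometric k`
             -- has constant term 1.
             (fromℕ< (>-nonZero⁻¹ (order T) {{IsTree.nonEmpty isTree}})) (const zero)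
      = proj₂ (proj₂ (χ-exists (G [ S ]))) (c , proper)
      where
      proper : Proper (G [ S ]) c
      -- The ends of an edge share a bag, so injectivity there separates their colours.
      proper u v uv cu≡cv with t , u∈ , v∈ ← edgeCover uv with refl ← inj t u∈ v∈ cu≡cv = irrefl G uv

mainTheorem13 : ∀ {ℓ} (𝒢 : GraphClass ℓ) → BoundedTreeα 𝒢 → PolynomiallyχBounded 𝒢
-- The inequality is decidable, hence stable under double negation, so the doubly negated existence
-- of the tree-independence number suffices; a decomposition attaining it is then used.
mainTheorem13 𝒢 (k , bounded) = geometric k , λ G G∈𝒢 S → decidable-stable (_ ≤? _) λ ¬χ≤ →
  IsTreeα-exists G λ { (m , tα@((𝒯 , refl) , _)) → ¬χ≤ (χ≤geometric 𝒯 (bounded G G∈𝒢 m tα) S) }
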